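{- $\Sigma^0_2\text{ - }\mathsf{DNE}_\mathbb{R}\equiv_{\sf W}\mathsf{Lim}_\mathbb{N}$.
   Context: $f\le_{\sf W}g$ for partial multifunctions on $\omega^\omega$: there are partial computable $H,K$ with $H(x)\in\mathrm{dom}(g)$ and $K(x,y)\in f(x)$ for all $x\in\mathrm{dom}(f)$, $y\in g(H(x))$; $\equiv_{\sf W}$ is reducibility both ways. $\Sigma^0_2\text{ - }\mathsf{DNE}_\mathbb{R}$ is the partial multifunction: given (the characteristic function of) a decidable relation $R\subseteq\mathbb{N}^2$ such that $\neg\neg\exists n\forall m R(n,m)$ (classically: $\exists n\forall m R(n,m)$), output some $n$ with $\forall m R(n,m)$. $\mathsf{Lim}_\mathbb{N}$: given a sequence $(a_i)_{i\in\mathbb{N}}$ of natural numbers which is eventually constant, output its eventual value. -}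

module Defs where

open import Level using (Level; suc; _⊔_)
open import Data.Nat using (ℕ; _≤_)
open import Data.Bool using (Bool; true)
open import Data.Product using (Σ; ∃; _×_; _,_)
open import Relation.Nullary using (¬_)
open import Relation.Binary.PropositionalEquality using (_≡_)

Baire : Set
Baire = ℕ → ℕ

record PMF (X Y : Set) : Set₁ where
  field
    dom : X → Set
    val : X → Y → Set
open PMF public

-- Weihrauch reducibility f ≤W g.  "Partial computable" realizers H, K are
-- rendered synthetically as Agda functions (every Agda-definable function is
-- computable); the correctness conditions are the ones of the definition.
_≤W_ : {X Y X' Y' : Set} → PMF X Y → PMF X' Y' → Set
_≤W_ {X} {Y} {X'} {Y'} f g =
  Σ (X → X') λ H → Σ (X → Y' → Y) λ K →
    (∀ x → dom f x → dom g (H x)) ×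
    (∀ x → dom f x → ∀ y → val g (H x) y → val f x (K x y))

_≡W_ : {X Y X' Y' : Set} → PMF X Y → PMF X' Y' → Set
f ≡W g = (f ≤W g) × (g ≤W f)

Σ⁰₂-DNE : PMF (ℕ → ℕ → Bool) ℕ
Σ⁰₂-DNE = record
  { dom = λ R → ¬ ¬ (∃ λ n → ∀ m → R n m ≡ true)
  ; val = λ R n → ∀ m → R n m ≡ true
  }

-- Eventually constant sequence (stated in double-negated, classically
-- equivalent form, since the paper's metatheory is classical).
EventuallyConstant : Baire → Set
EventuallyConstant a = ¬ ¬ (∃ λ N → ∀ k → N ≤ k → a k ≡ a N)

IsEventualValue : Baire → ℕ → Set
IsEventualValue a y = ∃ λ N → ∀ k → N ≤ k → a k ≡ y

Lim-ℕ : PMF Baire ℕ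
Lim-ℕ = record
  { dom = EventuallyConstant
  ; val = IsEventualValue
  }

{-# OPTIONS --safe #-}
-- Lim_ℕ ≤ DNE: let R(n,m) say a(n+m) = a(n); an n with ∀m R(n,m) is a point
-- from which a is constant, so a(n) is the limit.
-- DNE ≤ Lim_ℕ: at stage k guess the least n < k not yet refuted, i.e. with
-- R(n,m) for all m < k (and k if there is none).  The least true witness n₀
-- exists classically and every n < n₀ is refuted at a finite stage, so the
-- guesses settle on n₀.  Conversely a limit y of the guesses is eventually
-- below the stage, hence never refuted.  As the domain of DNE only provides
-- ¬¬∃, the convergence argument runs in the double-negation monad.
module Submission where

open import Defs
open import Level using (Level)
open import Data.Nat using (ℕ; zero; suc; _+_; _∸_; _≤_; _<_; _⊔_; z<s; s<s; s<s⁻¹; s≤s; _≟_)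
open import Data.Nat.Properties
  using (≤-refl; ≤-trans; <-≤-trans; m≤m+n; m+[n∸m]≡n; m<n⇒m<1+n; m≤m⊔n; m≤n⊔m; m<1+n⇒m<n∨m≡n; allUpTo?)
open import Data.Nat.Induction using (<-rec)
open import Data.Bool using (Bool; true)
open import Data.Bool.Properties using () renaming (_≟_ to _≟ᴮ_)
open import Data.Product using (∃; _×_; _,_)
open import Data.Sum using (inj₁; inj₂)
open import Function using (_∘_)
open import Effect.Monad using (RawMonad)
open import Relation.Unary using (Pred; Decidable)
open import Relation.Nullary using (¬_; Dec; yes; no; does; contradiction)
open import Relation.Nullary.Decidable using (dec-true; decidable-stable)
open import Relation.Nullary.Negation using (¬¬-Monad; ¬¬-map)
open import Relation.Binary.PropositionalEquality using (_≡_; refl; sym; trans; cong)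

private
  variable
    a p : Level
    A : Set a
    P : Pred ℕ p
    b n : ℕ

does-true⇒ : (A? : Dec A) → does A? ≡ true → A
does-true⇒ (yes x) _ = x

¬∀⇒¬¬∃¬ : Decidable P → ¬ (∀ x → P x) → ¬ ¬ ∃ (¬_ ∘ P)
¬∀⇒¬¬∃¬ P? ¬∀P ¬∃¬P = ¬∀P λ x → decidable-stable (P? x) (λ ¬Px → ¬∃¬P (x , ¬Px))

¬¬-∃-least : ¬ ¬ ∃ P → ¬ ¬ ∃ λ n → P n × (∀ {i} → i < n → ¬ P i)
¬¬-∃-least {P = P} ¬¬∃P ¬least = ¬¬∃P λ (n , Pn) → never n Pn
  where
  never : ∀ n → ¬ P n
  never = <-rec (¬_ ∘ P) λ n smaller Pn → ¬least (n , Pn , smaller)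

¬¬-∀< : ∀ n → (∀ {i} → i < n → ¬ ¬ P i) → ¬ ¬ (∀ {i} → i < n → P i)
¬¬-∀< zero _ k = k λ ()
¬¬-∀< {P = P} (suc n) ¬¬P k =
  ¬¬-∀< n (¬¬P ∘ m<n⇒m<1+n) λ below → ¬¬P ≤-refl λ Pn → k (λ i<1+n → extend below Pn i<1+n)
  where
  extend : (∀ {i} → i < n → P i) → P n → ∀ {i} → i < suc n → P i
  extend below Pn i<1+n with m<1+n⇒m<n∨m≡n i<1+n
  ... | inj₁ i<n = below i<n
  ... | inj₂ refl = Pn

Eventually : Pred ℕ p → Set p
Eventually P = ∃ λ N → ∀ k → N ≤ k → P k

eventually-∀< : {Q : ℕ → Pred ℕ p} → ∀ n →
                (∀ {i} → i < n → Eventually (Q i)) → Eventually (λ k → ∀ {i} → i < n → Q i k)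
eventually-∀< zero _ = 0 , λ _ _ ()
eventually-∀< {Q = Q} (suc n) ev
  with eventually-∀< n (ev ∘ m<n⇒m<1+n) | ev ≤-refl
... | N , below | M , atN = N ⊔ M , both
  where
  both : ∀ k → N ⊔ M ≤ k → ∀ {i} → i < suc n → Q i k
  both k N⊔M≤k i<1+n with m<1+n⇒m<n∨m≡n i<1+n
  ... | inj₁ i<n = below k (≤-trans (m≤m⊔n N M) N⊔M≤k) i<n
  ... | inj₂ refl = atN k (≤-trans (m≤n⊔m N M) N⊔M≤k)

eventualValue⇒eventuallyConstant : ∀ {a y} → IsEventualValue a y → ∃ λ N → ∀ k → N ≤ k → a k ≡ a N
eventualValue⇒eventuallyConstant (N , a≡y) = N , λ k N≤k → trans (a≡y k N≤k) (sym (a≡y N ≤-refl))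

-- the least i < b with P i, and b itself if there is none
least : Decidable P → ℕ → ℕ
least P? zero = zero
least P? (suc b) with P? 0
... | yes _ = 0
... | no _ = suc (least (P? ∘ suc) b)

least-minimal : (P? : Decidable P) → P n → n < b → (∀ {i} → i < n → ¬ P i) → least P? b ≡ n
least-minimal {n = zero} {b = suc _} P? Pn _ _ with P? 0
... | yes _ = refl
... | no ¬P0 = contradiction Pn ¬P0
least-minimal {n = suc _} {b = suc _} P? Pn n<b minimal with P? 0
... | yes P0 = contradiction P0 (minimal z<s)
... | no _ = cong suc (least-minimal (P? ∘ suc) Pn (s<s⁻¹ n<b) (minimal ∘ s<s))

least-found : (P? : Decidable P) → least P? b < b → P (least P? b)
least-found {b = suc _} P? lt with P? 0
... | yes P0 = P0
... | no _ = least-found (P? ∘ suc) (s<s⁻¹ lt)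

module _ (R : ℕ → ℕ → Bool) where

  Unrefuted : ℕ → ℕ → Set
  Unrefuted n k = ∀ {m} → m < k → R n m ≡ true

  unrefuted? : ∀ n k → Dec (Unrefuted n k)
  unrefuted? n = allUpTo? (λ m → R n m ≟ᴮ true)

  guess : ℕ → ℕ
  guess k = least (λ n → unrefuted? n k) k

  refuted-eventually : ∀ {i} → ∃ (λ m → ¬ R i m ≡ true) → Eventually (¬_ ∘ Unrefuted i)
  refuted-eventually (m , ¬Rim) = suc m , λ _ m<k unrefuted → ¬Rim (unrefuted m<k)

  guess-converges : (∀ m → R n m ≡ true) → Eventually (λ k → ∀ {i} → i < n → ¬ Unrefuted i k) →
                    IsEventualValue guess n
  guess-converges {n} witness (N , refuted) = N ⊔ suc n , λ k N⊔n<k →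
    least-minimal (λ i → unrefuted? i k) (λ {m} _ → witness m)
      (≤-trans (m≤n⊔m N (suc n)) N⊔n<k) (refuted k (≤-trans (m≤m⊔n N (suc n)) N⊔n<k))

  guess-eventuallyConstant : ¬ ¬ ∃ (λ n → ∀ m → R n m ≡ true) → EventuallyConstant guess
  guess-eventuallyConstant ¬¬witness = do
      n , witness , minimal ← ¬¬-∃-least ¬¬witness
      refuted ← ¬¬-∀< n λ i<n →
        ¬¬-map refuted-eventually (¬∀⇒¬¬∃¬ (λ m → _ ≟ᴮ true) (minimal i<n))
      return (eventualValue⇒eventuallyConstant (guess-converges witness (eventually-∀< n refuted)))
    where open RawMonad ¬¬-Monad

  guess-unrefuted : ∀ {k y} → guess k ≡ y → y < k → Unrefuted y k
  guess-unrefuted {k} refl y<k = least-found (λ n → unrefuted? n k) y<k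

  eventualValue-witness : ∀ {y} → IsEventualValue guess y → ∀ m → R y m ≡ true
  eventualValue-witness {y} (N , guess≡y) m =
    guess-unrefuted (guess≡y k (m≤m⊔n N _)) (below (s≤s (m≤m⊔n y m))) (below (s≤s (m≤n⊔m y m)))
    where
    k = N ⊔ suc (y ⊔ m)
    below : ∀ {i} → i < suc (y ⊔ m) → i < k
    below i<1+y⊔m = <-≤-trans i<1+y⊔m (m≤n⊔m N _)

Σ⁰₂-DNE≤Lim-ℕ : Σ⁰₂-DNE ≤W Lim-ℕ
Σ⁰₂-DNE≤Lim-ℕ = guess , (λ _ y → y) , guess-eventuallyConstant , λ R _ _ → eventualValue-witness R

constantFrom : (ℕ → ℕ) → ℕ → ℕ → Bool
constantFrom a n m = does (a (n + m) ≟ a n)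

Lim-ℕ≤Σ⁰₂-DNE : Lim-ℕ ≤W Σ⁰₂-DNE
Lim-ℕ≤Σ⁰₂-DNE = constantFrom , (λ a n → a n) , witnessed , limit
  where
  witnessed : ∀ a → EventuallyConstant a → ¬ ¬ ∃ λ n → ∀ m → constantFrom a n m ≡ true
  witnessed a = ¬¬-map λ (N , a≡aN) → N , λ m → dec-true (a (N + m) ≟ a N) (a≡aN (N + m) (m≤m+n N m))
  limit : ∀ a → EventuallyConstant a → ∀ n → (∀ m → constantFrom a n m ≡ true) → IsEventualValue a (a n)
  limit a _ n constant = n , λ k n≤k →
    trans (cong a (sym (m+[n∸m]≡n n≤k))) (does-true⇒ (a (n + (k ∸ n)) ≟ a n) (constant (k ∸ n)))

proposition3p1 : Σ⁰₂-DNE ≡W Lim-ℕ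
proposition3p1 = Σ⁰₂-DNE≤Lim-ℕ , Lim-ℕ≤Σ⁰₂-DNE
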